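{- For every integer $m\ge 1$ there exists an integer $n_0=n_0(m)$ such that the following holds for all integers $k\ge 2$, $t\ge 1$ and $1\le n_1\le n_2\le\cdots\le n_k$, and every non-empty set $R\subseteq[n_1]$ of integers with $\min R\ge t$, $\max R=m$ and $n_2\ge n_0$. Let $\mathscr{F}\subseteq\mathcal{K}_R(n_1,\ldots,n_k)$ be a $t$-intersecting family. Then \[ |\mathscr{F}|\le\sum_{r\in R}\frac{(n_1-t)_{r-t}\cdots(n_k-t)_{r-t}}{(r-t)!}. \] Furthermore, equality is attained if and only if $\mathscr{F}$ is a $t$-star of $\mathcal{K}_R(n_1,\ldots,n_k)$.
   Context: For a positive integer $n$, $[n]=\{1,\ldots,n\}$. For non-negative integers $b\le a$, $(a)_b=\frac{a!}{(a-b)!}$. $\mathcal{K}(n_1,\ldots,n_k)$ denotes the complete $k$-partite $k$-graph with parts $[n_1],\ldots,[n_k]$ (regarded as disjoint); its edges are identified with the $k$-tuples $(x_1,\ldots,x_k)\in[n_1]\times\cdots\times[n_k]$. An $r$-matching is a set of $r$ pairwise vertex-disjoint edges, i.e. a set of $r$ such $k$-tuples any two of which differ in every coordinate. $\mathcal{K}_r(n_1,\ldots,n_k)$ is the set of all $r$-matchings of $\mathcal{K}(n_1,\ldots,n_k)$, and $\mathcal{K}_R(n_1,\ldots,n_k)=\bigcup_{r\in R}\mathcal{K}_r(n_1,\ldots,n_k)$. A family $\mathscr{F}\subseteq\mathcal{K}_R(n_1,\ldots,n_k)$ is $t$-intersecting if any two members of $\mathscr{F}$ share at least $t$ edges. A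 $t$-star of $\mathcal{K}_R(n_1,\ldots,n_k)$ is a family of the form $\{M\in\mathcal{K}_R(n_1,\ldots,n_k): C\subseteq M\}$ for some $t$-matching $C\in\mathcal{K}_t(n_1,\ldots,n_k)$. -}

module Defs where

open import Data.Fin.Base using (Fin; zero; suc)
import Data.Fin.Properties as Fin
open import Data.List.Base using (List; length; filter; map)
open import Data.List.Membership.Propositional using (_∈_)
import Data.List.Membership.DecPropositional as DecMembership
import Data.List.Membership.Setoid as SetoidMembership
open import Data.List.Relation.Binary.BagAndSetEquality using ([_]-Equality; set)
open import Data.List.Relation.Binary.Subset.Propositional using (_⊆_)
open import Data.List.Relation.Unary.All using (All)
open import Data.List.Relation.Unary.AllPairs using (AllPairs)
import Data.List.Relation.Unary.Unique.Setoid as SetoidUnique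
open import Data.Nat.Base using (ℕ; _*_; _∸_; _≤_; _/_; _!)
open import Data.Nat.Combinatorics using (_P_)
open import Data.Nat.ListAction using (sum)
open import Data.Nat.Properties using (_!≢0)
open import Data.Product.Base using (∃; _×_; _,_; uncurry)
import Data.Vec.Base as Vec
open Vec using (Vec)
open import Data.Vec.Relation.Unary.All using ([]; _∷_) renaming (All to Allᵛ)
open import Function.Bundles using (_⇔_)
open import Level using (0ℓ)
open import Relation.Binary.Bundles using (Setoid)
open import Relation.Binary.Definitions using (DecidableEquality)
import Relation.Binary.Construct.On as On
open import Relation.Binary.PropositionalEquality using (_≡_; _≢_; refl; cong₂)
open import Relation.Nullary.Decidable using (yes; map′; _×-dec_)

private
  variable
    k : ℕ
    ns : Vec ℕ k

-- Edges of 𝒦(n₁,…,nₖ): tuples in Fin n₁ × ⋯ × Fin nₖ, with Fin n in the role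
-- of {1,…,n}.
Edge : Vec ℕ k → Set
Edge ns = Allᵛ Fin ns

coord : Edge ns → (i : Fin k) → Fin (Vec.lookup ns i)
coord (x ∷ e) zero    = x
coord (x ∷ e) (suc i) = coord e i

_≟ᴱ_ : DecidableEquality (Edge ns)
[]      ≟ᴱ []      = yes refl
(x ∷ e) ≟ᴱ (y ∷ f) =
  map′ (uncurry (cong₂ _∷_)) (λ { refl → refl , refl }) ((x Fin.≟ y) ×-dec (e ≟ᴱ f))

VertexDisjoint : Edge {k} ns → Edge ns → Set
VertexDisjoint e f = ∀ i → coord e i ≢ coord f i

-- A finite set of pairwise vertex-disjoint edges, listed in some order. For
-- k ≥ 1 vertex-disjointness is irreflexive, so no edge is listed twice.
record Matching (ns : Vec ℕ k) : Set where
  constructor matching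
  field
    edges    : List (Edge ns)
    disjoint : AllPairs VertexDisjoint edges

open Matching public

∣_∣ : Matching ns → ℕ
∣ M ∣ = length (edges M)

∣_∩_∣ : Matching ns → Matching ns → ℕ
∣ M ∩ N ∣ = length (filter (_∈? edges N) (edges M))
  where open DecMembership _≟ᴱ_ using (_∈?_)

-- Two matchings are identified when they have the same edges, in any order.
matchingSetoid : Vec ℕ k → Setoid 0ℓ 0ℓ
matchingSetoid ns = On.setoid ([ set ]-Equality (Edge ns)) (edges {ns = ns})

_∈𝒦[_] : Matching ns → List ℕ → Set
M ∈𝒦[ R ] = ∣ M ∣ ∈ R

-- A list of matchings pairwise distinct as sets of edges, so that the length of
-- the list is the cardinality of the family.
record IsFamily {ns : Vec ℕ k} (R : List ℕ) (ℱ : List (Matching ns)) : Set where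
  open SetoidUnique (matchingSetoid ns) using (Unique)
  field
    members  : All (_∈𝒦[ R ]) ℱ
    distinct : Unique ℱ

Intersecting : ℕ → List (Matching ns) → Set
Intersecting t ℱ = ∀ {M N} → M ∈ ℱ → N ∈ ℱ → t ≤ ∣ M ∩ N ∣

IsStar : {ns : Vec ℕ k} → ℕ → List ℕ → List (Matching ns) → Set
IsStar {ns = ns} t R ℱ =
  ∃ λ (C : Matching ns) → ∣ C ∣ ≡ t ×
    (∀ M → M ∈ᴹ ℱ ⇔ (M ∈𝒦[ R ] × edges C ⊆ edges M))
  where open SetoidMembership (matchingSetoid ns) using () renaming (_∈_ to _∈ᴹ_)

-- The summand (n₁-t)_{r-t} ⋯ (nₖ-t)_{r-t} / (r-t)!. For k ≥ 1 the factorial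
-- divides each falling factorial, so the natural-number division is exact; the
-- subtractions do not truncate when t ≤ r and t ≤ nᵢ.
starTerm : Vec ℕ k → ℕ → ℕ → ℕ
starTerm ns t r =
  Vec.foldr′ _*_ 1 (Vec.map (λ n → (n ∸ t) P (r ∸ t)) ns) / (r ∸ t) !
  where instance _ = (r ∸ t) !≢0

starBound : Vec ℕ k → ℕ → List ℕ → ℕ
starBound ns t R = sum (map (starTerm ns t) R)

module Submission where

-- Fix M₀ ∈ ℱ. Every member of ℱ contains one of the at most 2ᵐ t-subsets T of
-- M₀. If some T lies in all members, ℱ is part of a t-star. Otherwise, for each
-- T some N ∈ ℱ misses part of T; a member M ⊇ T shares t edges with N, not all
-- of them in T, so M contains T ∪ {e} for one of the at most m edges e of N.
-- Hence |ℱ| is at most 2ᵐ · m times the number of members of 𝒦_R containing a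
-- given (t+1)-matching. As (r-t) N_t(r) = ∏ᵢ (nᵢ-t) · N_{t+1}(r), where N_s(r)
-- counts the r-matchings containing a given s-matching, this is less than the
-- size of a t-star once n₂ is large.

open import Defs

open import Data.Bool.Base using (true; false)
open import Data.Fin.Base using (Fin; zero; suc)
import Data.Fin.Properties as Fin
open import Data.List.Base using
  (List; []; _∷_; _++_; length; filter; map; concatMap; allFin; cartesianProductWith)
open import Data.List.Extrema.Nat using (min; max; min≤xs; xs≤max)
import Data.List.Membership.DecPropositional as DecMembership
open import Data.List.Membership.Propositional using (_∈_; _∉_; find; lose)
open import Data.List.Membership.Propositional.Properties
import Data.List.Membership.Setoid as SetoidMembership
open import Data.List.Properties using
  (length-map; length-++; length-tabulate; filter-accept; filter-reject; filter-none)
open import Data.List.Relation.Binary.BagAndSetEquality using ([_]-Equality; set; _∼[_]_)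
open import Data.List.Relation.Binary.Subset.Propositional using (_⊆_)
open import Data.List.Relation.Unary.All as All using (All; []; _∷_)
import Data.List.Relation.Unary.All.Properties as All
open import Data.List.Relation.Unary.AllPairs as AllPairs using (AllPairs; []; _∷_)
import Data.List.Relation.Unary.AllPairs.Properties as AllPairs
open import Data.List.Relation.Unary.Any as Any using (Any; here; there; any?)
import Data.List.Relation.Unary.Any.Properties as Any
open import Data.List.Relation.Unary.Unique.Propositional using (Unique)
import Data.List.Relation.Unary.Unique.Propositional.Properties as Unique
open import Data.Nat.Base
open import Data.Nat.Combinatorics
open import Data.Nat.Combinatorics.Specification
open import Data.Nat.Divisibility
open import Data.Nat.DivMod
open import Data.Nat.Properties
open import Algebra.Properties.CommutativeSemigroup *-commutativeSemigroup using
  (x∙yz≈y∙xz; xy∙z≈xz∙y; xy∙z≈y∙xz; interchange)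
open import Data.Product.Base using (_×_; ∃; _,_; proj₁; proj₂; uncurry)
open import Data.Sum.Base using (_⊎_; inj₁; inj₂; [_,_]′)
import Data.Vec.Base as Vec
open Vec using (Vec; []; _∷_)
open import Data.Vec.Relation.Unary.All as Allᵛ using ([]; _∷_) renaming (All to Allᵛ)
open import Data.Vec.Relation.Unary.Linked using (Linked)
open import Data.Vec.Relation.Unary.Linked.Properties using (Linked⇒All)
open import Function.Base using (_∘_; id; case_of_)
open import Function.Bundles using (_⇔_; Equivalence; mk⇔)
open Equivalence using (to; from)
open import Level using (Level)
open import Relation.Binary.Bundles using (Setoid)
open import Relation.Binary.Core using (Rel)
open import Relation.Binary.PropositionalEquality using
  (_≡_; _≢_; refl; sym; trans; cong; cong₂; subst; setoid; module ≡-Reasoning)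
open import Relation.Nullary using (¬_; yes; no; contradiction)
open import Relation.Nullary.Decidable using (¬?; _×-dec_; decidable-stable)
open import Relation.Unary using (Pred; Decidable)

private
  variable
    a b ℓ p : Level
    A : Set a
    B : Set b
    k n t : ℕ
    R : List ℕ
    ns : Vec ℕ k
    e f : Edge ns
    L M : List (Edge ns)
    ℱ : List (Matching ns)

-- Finite lists

-- Over a setoid, because two equalities occur: propositional equality for edges, and set equality
-- for matchings listed in some order.
module Pigeonhole {a ℓ} (S : Setoid a ℓ) where
  open Setoid S using (Carrier; _≈_) renaming (sym to ≈-sym; trans to ≈-trans; refl to ≈-refl)
  open import Data.List.Membership.Setoid S using () renaming (_∈_ to _∈ₛ_)
  open import Data.List.Relation.Unary.Unique.Setoid S using () renaming (Unique to Uniqueₛ)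
  open import Data.List.Relation.Binary.Subset.Setoid S using () renaming (_⊆_ to _⊆ₛ_)

  private
    infixl 9 _─_
    _─_ : ∀ {x} ys → x ∈ₛ ys → List Carrier
    ys ─ p = ys Any.─ p

    length-─ : ∀ {x} ys (p : x ∈ₛ ys) → length ys ≡ suc (length (ys ─ p))
    length-─ (y ∷ ys) (here _)  = refl
    length-─ (y ∷ ys) (there p) = cong suc (length-─ ys p)

    ∈-─⁺ : ∀ {x z ys} (p : x ∈ₛ ys) → z ∈ₛ ys → ¬ x ≈ z → z ∈ₛ ys ─ p
    ∈-─⁺ (here x≈y) (here z≈y) x≉z = contradiction (≈-trans x≈y (≈-sym z≈y)) x≉z
    ∈-─⁺ (here x≈y) (there q)  x≉z = q
    ∈-─⁺ (there p)  (here z≈y) x≉z = here z≈y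
    ∈-─⁺ (there p)  (there q)  x≉z = there (∈-─⁺ p q x≉z)

    ∈-─⁻ : ∀ {x z ys} (p : x ∈ₛ ys) → z ∈ₛ ys → z ≈ x ⊎ z ∈ₛ ys ─ p
    ∈-─⁻ (here x≈y) (here z≈y) = inj₁ (≈-trans z≈y (≈-sym x≈y))
    ∈-─⁻ (here x≈y) (there q)  = inj₂ q
    ∈-─⁻ (there p)  (here z≈y) = inj₂ (here z≈y)
    ∈-─⁻ (there p)  (there q) with ∈-─⁻ p q
    ... | inj₁ z≈x = inj₁ z≈x
    ... | inj₂ q′  = inj₂ (there q′)

    ⊆-─ : ∀ {x xs ys} → All (λ z → ¬ x ≈ z) xs → (s : (x ∷ xs) ⊆ₛ ys) → xs ⊆ₛ ys ─ s (here ≈-refl)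
    ⊆-─ x≉ s {z} z∈xs = ∈-─⁺ (s (here ≈-refl)) (s (there z∈xs)) λ x≈z →
      All.lookupₛ S (λ y≈w x≉y x≈w → x≉y (≈-trans x≈w (≈-sym y≈w))) x≉ z∈xs x≈z

  unique-⊆⇒length≤ : ∀ {xs ys} → Uniqueₛ xs → xs ⊆ₛ ys → length xs ≤ length ys
  unique-⊆⇒length≤ []       s = z≤n
  unique-⊆⇒length≤ {ys = ys} (x≉ ∷ u) s =
    ≤-trans (s≤s (unique-⊆⇒length≤ u (⊆-─ x≉ s)))
            (≤-reflexive (sym (length-─ ys (s (here ≈-refl)))))

  -- Deleting from `ys` the partner of the head of `xs` preserves all hypotheses; an element of `ys`
  -- is equal to that partner or survives the deletion. This drives the equality case.
  unique-⊆⇒⊇ : ∀ {xs ys} → Uniqueₛ xs → xs ⊆ₛ ys → length ys ≤ length xs → ys ⊆ₛ xs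
  unique-⊆⇒⊇ {ys = []}     []       s l ()
  unique-⊆⇒⊇ {ys = _ ∷ _}  []       s ()
  unique-⊆⇒⊇ {ys = ys} (x≉ ∷ u) s l z∈ys
    with ∈-─⁻ (s (here ≈-refl)) z∈ys
  ... | inj₁ z≈x = here z≈x
  ... | inj₂ z∈  = there (unique-⊆⇒⊇ u (⊆-─ x≉ s)
                     (s≤s⁻¹ (≤-trans (≤-reflexive (sym (length-─ ys (s (here ≈-refl))))) l)) z∈)

module _ {A : Set a} where
  open Pigeonhole (setoid A) public

allPairs-∈ : ∀ {ℓ′} {R : Rel A ℓ} {S : Rel A ℓ′} {xs} → AllPairs R xs →
  (∀ {x y} → x ∈ xs → y ∈ xs → R x y → S x y) → AllPairs S xs
allPairs-∈ []       h = []
allPairs-∈ (r ∷ rs) h =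
  All.tabulate (λ y∈ → h (here refl) (there y∈) (All.lookup r y∈)) ∷
  allPairs-∈ rs λ x∈ y∈ → h (there x∈) (there y∈)

allPairs-concatMap⁺ : {R : Rel B ℓ} {f : A → List B} {xs : List A} →
  (∀ {x} → x ∈ xs → AllPairs R (f x)) →
  AllPairs (λ x y → ∀ {u v} → u ∈ f x → v ∈ f y → R u v) xs →
  AllPairs R (concatMap f xs)
allPairs-concatMap⁺ {xs = []}     w []       = []
allPairs-concatMap⁺ {R = R} {f} {x ∷ xs} w (b ∷ bs) =
  AllPairs.++⁺ (w (here refl)) (allPairs-concatMap⁺ {R = R} {f} (w ∘ there) bs)
    (All.tabulate λ u∈ → All.tabulate λ v∈ →
      let y , y∈ , v∈fy = find (∈-concatMap⁻ f v∈) in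
      All.lookup b y∈ u∈ v∈fy)

length-concatMap-const : ∀ {f : A → List B} {n} xs →
  (∀ {x} → x ∈ xs → length (f x) ≡ n) → length (concatMap f xs) ≡ length xs * n
length-concatMap-const []       h = refl
length-concatMap-const {f = f} (x ∷ xs) h =
  trans (length-++ (f x)) (cong₂ _+_ (h (here refl)) (length-concatMap-const xs (h ∘ there)))

length-cartesianProductWith : ∀ {c} {C : Set c} (f : A → B → C) xs ys →
  length (cartesianProductWith f xs ys) ≡ length xs * length ys
length-cartesianProductWith f []       ys = refl
length-cartesianProductWith f (x ∷ xs) ys = trans (length-++ (map (f x) ys))
  (cong₂ _+_ (length-map (f x) ys) (length-cartesianProductWith f xs ys))

length-filter-¬ : {P : Pred A p} (P? : Decidable P) (xs : List A) →
  length (filter P? xs) + length (filter (¬? ∘ P?) xs) ≡ length xs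
length-filter-¬ P? []       = refl
length-filter-¬ P? (x ∷ xs) with P? x
... | yes _ = cong suc (length-filter-¬ P? xs)
... | no  _ = trans (+-suc _ _) (cong suc (length-filter-¬ P? xs))

length-filter-filter≤ : ∀ {q} {P : Pred A p} {Q : Pred A q} (P? : Decidable P) (Q? : Decidable Q) xs →
  length (filter P? (filter Q? xs)) ≤ length (filter P? xs)
length-filter-filter≤ P? Q? [] = z≤n
length-filter-filter≤ P? Q? (x ∷ xs) with Q? x
length-filter-filter≤ P? Q? (x ∷ xs) | yes _ with P? x
... | yes _ = s≤s (length-filter-filter≤ P? Q? xs)
... | no  _ = length-filter-filter≤ P? Q? xs
length-filter-filter≤ P? Q? (x ∷ xs) | no _ with P? x
... | yes _ = m≤n⇒m≤1+n (length-filter-filter≤ P? Q? xs)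
... | no  _ = length-filter-filter≤ P? Q? xs

-- A union bound: split off the entries with `P i`; the others are covered by the remaining indices,
-- and discarding entries cannot raise a count.
length-cover : {P : A → Pred B p} (P? : ∀ i → Decidable (P i)) {n : ℕ} (is : List A) (xs : List B) →
  (∀ {x} → x ∈ xs → Any (λ i → P i x) is) →
  (∀ {i} → i ∈ is → length (filter (P? i) xs) ≤ n) →
  length xs ≤ length is * n
length-cover P? []       []       cov bnd = z≤n
length-cover P? []       (x ∷ xs) cov bnd with () ← cov (here refl)
length-cover {P = P} P? {n} (i ∷ is) xs cov bnd = begin
  length xs                                              ≡⟨ length-filter-¬ (P? i) xs ⟨
  length (filter (P? i) xs) + length xs′                 ≤⟨ +-mono-≤ (bnd (here refl)) ih ⟩
  n + length is * n                                      ∎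
  where
  open ≤-Reasoning
  xs′ = filter (¬? ∘ P? i) xs
  cov′ : ∀ {x} → x ∈ xs′ → Any (λ j → P j x) is
  cov′ x∈ with x∈xs , ¬Pi ← ∈-filter⁻ (¬? ∘ P? i) {xs = xs} x∈ = Any.tail ¬Pi (cov x∈xs)
  ih = length-cover P? is xs′ cov′ λ {j} j∈ →
    ≤-trans (length-filter-filter≤ (P? j) (¬? ∘ P? i) xs) (bnd (there j∈))

-- Sublists of given length

choose : ℕ → List A → List (List A)
choose zero    xs       = [] ∷ []
choose (suc t) []       = []
choose (suc t) (x ∷ xs) = map (x ∷_) (choose t xs) ++ choose (suc t) xs

length-choose≤ : ∀ t (xs : List A) → length (choose t xs) ≤ 2 ^ length xs
length-choose≤ zero    xs       = ^-monoʳ-≤ 2 {0} {length xs} z≤n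
length-choose≤ (suc t) []       = z≤n
length-choose≤ (suc t) (x ∷ xs) = begin
  length (map (x ∷_) (choose t xs) ++ choose (suc t) xs) ≡⟨ length-++ (map (x ∷_) (choose t xs)) ⟩
  length (map (x ∷_) (choose t xs)) + length (choose (suc t) xs)
    ≡⟨ cong (_+ length (choose (suc t) xs)) (length-map (x ∷_) (choose t xs)) ⟩
  length (choose t xs) + length (choose (suc t) xs)
    ≤⟨ +-mono-≤ (length-choose≤ t xs) (length-choose≤ (suc t) xs) ⟩
  2 ^ length xs + 2 ^ length xs ≡⟨ cong (2 ^ length xs +_) (+-identityʳ _) ⟨
  2 ^ length (x ∷ xs) ∎
  where open ≤-Reasoning

length-∈-choose : ∀ t (xs : List A) {ys} → ys ∈ choose t xs → length ys ≡ t
length-∈-choose zero    xs       (here refl) = refl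
length-∈-choose (suc t) (x ∷ xs) ys∈ with ∈-++⁻ (map (x ∷_) (choose t xs)) ys∈
... | inj₂ ys∈′ = length-∈-choose (suc t) xs ys∈′
... | inj₁ ys∈′ with zs , zs∈ , refl ← ∈-map⁻ (x ∷_) ys∈′ = cong suc (length-∈-choose t xs zs∈)

∈-choose⇒⊆ : ∀ t (xs : List A) {ys} → ys ∈ choose t xs → ys ⊆ xs
∈-choose⇒⊆ zero    xs       (here refl) ()
∈-choose⇒⊆ (suc t) (x ∷ xs) ys∈ y∈ with ∈-++⁻ (map (x ∷_) (choose t xs)) ys∈
... | inj₂ ys∈′ = there (∈-choose⇒⊆ (suc t) xs ys∈′ y∈)
... | inj₁ ys∈′ with zs , zs∈ , refl ← ∈-map⁻ (x ∷_) ys∈′ with y∈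
...   | here refl  = here refl
...   | there y∈zs = there (∈-choose⇒⊆ t xs zs∈ y∈zs)

allPairs-∈-choose : ∀ {R : Rel A ℓ} t {xs ys} → AllPairs R xs → ys ∈ choose t xs → AllPairs R ys
allPairs-∈-choose zero    rs       (here refl) = []
allPairs-∈-choose (suc t) {x ∷ xs} (r ∷ rs) ys∈ with ∈-++⁻ (map (x ∷_) (choose t xs)) ys∈
... | inj₂ ys∈′ = allPairs-∈-choose (suc t) rs ys∈′
... | inj₁ ys∈′ with zs , zs∈ , refl ← ∈-map⁻ (x ∷_) ys∈′ =
  All.anti-mono (∈-choose⇒⊆ t xs zs∈) r ∷ allPairs-∈-choose t rs zs∈

choose-filter : {P : Pred A p} (P? : Decidable P) (t : ℕ) (xs : List A) →
  t ≤ length (filter P? xs) → Any (All P) (choose t xs)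
choose-filter P? zero    xs       t≤ = here []
choose-filter P? (suc t) (x ∷ xs) t≤ with P? x
... | yes Px = Any.++⁺ˡ (Any.map⁺ (Any.map (Px ∷_) (choose-filter P? t xs (s≤s⁻¹ t≤))))
... | no _   = Any.++⁺ʳ (map (x ∷_) (choose t xs)) (choose-filter P? (suc t) xs t≤)

-- Complements in `Fin n`

module _ {n : ℕ} where
  open DecMembership (Fin._≟_ {n}) using (_∉?_; _∈?_)

  complement : List (Fin n) → List (Fin n)
  complement xs = filter (_∉? xs) (allFin n)

  ∈-complement⁺ : ∀ {xs x} → x ∉ xs → x ∈ complement xs
  ∈-complement⁺ {xs} {x} = ∈-filter⁺ (_∉? xs) (∈-allFin x)

  ∈-complement⁻ : ∀ {xs x} → x ∈ complement xs → x ∉ xs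
  ∈-complement⁻ {xs} x∈ = proj₂ (∈-filter⁻ (_∉? xs) {xs = allFin n} x∈)

  complement-unique : ∀ xs → Unique (complement xs)
  complement-unique xs = Unique.filter⁺ (_∉? xs) (Unique.allFin⁺ n)

  -- `xs ++ complement xs` lists `Fin n` without repetition, so its length is `n`.
  length-complement : ∀ {xs} → Unique xs → length (complement xs) ≡ n ∸ length xs
  length-complement {xs} u = sym (begin
    n ∸ length xs                                  ≡⟨ cong (_∸ length xs) all≡ ⟨
    length (xs ++ complement xs) ∸ length xs       ≡⟨ cong (_∸ length xs) (length-++ xs) ⟩
    length xs + length (complement xs) ∸ length xs ≡⟨ m+n∸m≡n (length xs) _ ⟩
    length (complement xs)                         ∎)
    where
    open ≡-Reasoning
    all⊆ : allFin n ⊆ xs ++ complement xs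
    all⊆ {x} _ with x ∈? xs
    ... | yes x∈ = ∈-++⁺ˡ x∈
    ... | no  x∉ = ∈-++⁺ʳ xs (∈-complement⁺ x∉)
    all≡ : length (xs ++ complement xs) ≡ n
    all≡ = trans
      (≤-antisym
        (unique-⊆⇒length≤ (Unique.++⁺ u (complement-unique xs) λ (x∈ , x∈c) → ∈-complement⁻ {xs} x∈c x∈)
          (λ {x} _ → ∈-allFin x))
        (unique-⊆⇒length≤ (Unique.allFin⁺ n) all⊆))
      (length-tabulate {n = n} id)

-- Falling factorials

∏ : Vec ℕ k → ℕ
∏ = Vec.foldr′ _*_ 1

∏-const1 : (ns : Vec ℕ k) → ∏ (Vec.map (λ _ → 1) ns) ≡ 1
∏-const1 []       = refl
∏-const1 (n ∷ ns) = trans (+-identityʳ _) (∏-const1 ns)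

-- Splitting off the largest factor is what relates falling factorials of `n ∸ t` to those of
-- `n ∸ suc t`.
nP[1+k]≡n*[n-1]Pk : ∀ n k → n P suc k ≡ n * (pred n P k)
nP[1+k]≡n*[n-1]Pk zero    k       = refl
nP[1+k]≡n*[n-1]Pk (suc n) zero    = refl
-- Both falling factorials reduce to the same Boolean test; when it fails, both are 0.
nP[1+k]≡n*[n-1]Pk (suc n) (suc k) with k <ᵇ n
... | true  = nP′k≡n[n∸1P′k∸1] (suc n) (suc (suc k))
... | false = sym (*-zeroʳ n)

nCk*k!≡nPk : ∀ n k → (n C k) * k ! ≡ n P k
nCk*k!≡nPk n k with k ≤? n
... | no k≰n = trans (cong (_* k !) (k>n⇒nCk≡0 (≰⇒> k≰n))) (sym (k>n⇒nPk≡0 (≰⇒> k≰n)))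
... | yes k≤n = trans (cong (_* k !) (nCk≡nPk/k! k≤n)) (m/n*n≡m k!∣nPk)
  where
  instance _ = k !≢0
  k!∣nPk : k ! ∣ n P k
  k!∣nPk with k ≤ᵇ n
  ... | true  = k!∣nP′k k≤n
  ... | false = (k !) ∣0

-- Holds factor by factor. The left side chooses one edge disjoint from `l` given ones and then `q`
-- more in order; the right side chooses all `suc q` in order. It serves both the count of
-- extensions and the comparison of stars.
∏-∸-P : (ns : Vec ℕ k) (l q : ℕ) →
  ∏ (Vec.map (_∸ l) ns) * ∏ (Vec.map (λ n → (n ∸ suc l) P q) ns) ≡ ∏ (Vec.map (λ n → (n ∸ l) P suc q) ns)
∏-∸-P []       l q = refl
∏-∸-P (n ∷ ns) l q = begin
  (n ∸ l) * ∏ (Vec.map (_∸ l) ns) * (((n ∸ suc l) P q) * ∏ (Vec.map (λ n → (n ∸ suc l) P q) ns))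
    ≡⟨ interchange (n ∸ l) _ _ _ ⟩
  (n ∸ l) * ((n ∸ suc l) P q) * (∏ (Vec.map (_∸ l) ns) * ∏ (Vec.map (λ n → (n ∸ suc l) P q) ns))
    ≡⟨ cong₂ _*_ (trans (cong (λ x → (n ∸ l) * (x P q)) (sym (pred[m∸n]≡m∸[1+n] n l))) (sym (nP[1+k]≡n*[n-1]Pk (n ∸ l) q)))
                 (∏-∸-P ns l q) ⟩
  ((n ∸ l) P suc q) * ∏ (Vec.map (λ n → (n ∸ l) P suc q) ns) ∎
  where open ≡-Reasoning

-- Matchings containing a given matching

Disjoint : List (Edge ns) → Set
Disjoint = AllPairs VertexDisjoint

vertexDisjoint-sym : (e f : Edge ns) → VertexDisjoint e f → VertexDisjoint f e
vertexDisjoint-sym e f d i eq = d i (sym eq)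

vertexDisjoint-head : (e f : Edge (n ∷ ns)) → VertexDisjoint e f → Allᵛ.head e ≢ Allᵛ.head f
vertexDisjoint-head (_ ∷ _) (_ ∷ _) d = d zero

vertexDisjoint-tail : (e f : Edge (n ∷ ns)) → VertexDisjoint e f → VertexDisjoint (Allᵛ.tail e) (Allᵛ.tail f)
vertexDisjoint-tail (_ ∷ _) (_ ∷ _) d = d ∘ suc

vertexDisjoint-∷ : {x : Fin n} {e : Edge ns} (f : Edge (n ∷ ns)) →
  x ≢ Allᵛ.head f → VertexDisjoint e (Allᵛ.tail f) → VertexDisjoint (x ∷ e) f
vertexDisjoint-∷ (_ ∷ _) x≢ d zero    = x≢
vertexDisjoint-∷ (_ ∷ _) x≢ d (suc i) = d i

disjoint-heads : {L : List (Edge (n ∷ ns))} → Disjoint L → Unique (map Allᵛ.head L)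
disjoint-heads = AllPairs.map⁺ ∘ AllPairs.map λ {e} {f} → vertexDisjoint-head e f

disjoint-tails : {L : List (Edge (n ∷ ns))} → Disjoint L → Disjoint (map Allᵛ.tail L)
disjoint-tails = AllPairs.map⁺ ∘ AllPairs.map λ {e} {f} → vertexDisjoint-tail e f

-- The first coordinate makes vertex-disjointness irreflexive; with no coordinates it would be
-- vacuous.
disjoint⇒unique : {L : List (Edge (n ∷ ns))} → Disjoint L → Unique L
disjoint⇒unique = AllPairs.map λ where d refl → d zero refl

disjoint-∈ : {L : List (Edge ns)} → Disjoint L → e ∈ L → f ∈ L → e ≢ f → VertexDisjoint e f
disjoint-∈ {e = e} {f} dis e∈ f∈ e≢f with ∈-AllPairs₂ dis e∈ f∈
... | inj₁ e≡f        = contradiction e≡f e≢f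
... | inj₂ (inj₁ d)   = d
... | inj₂ (inj₂ d)   = vertexDisjoint-sym f e d

-- An edge of a matching is determined by its first vertex. This makes enumerating matchings by
-- first vertices free of repetition.
disjoint-head : {L : List (Edge (n ∷ ns))} → Disjoint L → e ∈ L → f ∈ L →
  Allᵛ.head e ≡ Allᵛ.head f → e ≡ f
disjoint-head {e = e@(_ ∷ _)} {f@(_ ∷ _)} dis e∈ f∈ eq with e ≟ᴱ f
... | yes e≡f = e≡f
... | no  e≢f = contradiction eq (disjoint-∈ dis e∈ f∈ e≢f zero)

-- Vertex-disjointness is coordinatewise, so the edges disjoint from all of `L` form the product of
-- the sets of free vertices.
disjointEdges : (ns : Vec ℕ k) → List (Edge ns) → List (Edge ns)
disjointEdges []       L = [] ∷ []
disjointEdges (n ∷ ns) L =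
  cartesianProductWith _∷_ (complement (map Allᵛ.head L)) (disjointEdges ns (map Allᵛ.tail L))

length-disjointEdges : (ns : Vec ℕ k) {L : List (Edge ns)} → Disjoint L →
  length (disjointEdges ns L) ≡ ∏ (Vec.map (_∸ length L) ns)
length-disjointEdges []       dis = refl
length-disjointEdges (n ∷ ns) {L} dis = trans
  (length-cartesianProductWith _∷_ (complement (map Allᵛ.head L)) _)
  (cong₂ _*_
    (trans (length-complement (disjoint-heads dis)) (cong (n ∸_) (length-map Allᵛ.head L)))
    (trans (length-disjointEdges ns (disjoint-tails dis))
           (cong (λ l → ∏ (Vec.map (_∸ l) ns)) (length-map Allᵛ.tail L))))

disjointEdges-unique : (ns : Vec ℕ k) (L : List (Edge ns)) → Unique (disjointEdges ns L)
disjointEdges-unique []       L = [] ∷ []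
disjointEdges-unique (n ∷ ns) L =
  Unique.cartesianProductWith⁺ _∷_ (λ where refl → refl , refl)
    (complement-unique (map Allᵛ.head L)) (disjointEdges-unique ns (map Allᵛ.tail L))

∈-disjointEdges⁺ : (ns : Vec ℕ k) {L : List (Edge ns)} {e : Edge ns} →
  (∀ {f} → f ∈ L → VertexDisjoint e f) → e ∈ disjointEdges ns L
∈-disjointEdges⁺ []       {e = []}    d = here refl
∈-disjointEdges⁺ (n ∷ ns) {L} {x ∷ e} d = ∈-cartesianProductWith⁺ _∷_
  (∈-complement⁺ {xs = map Allᵛ.head L} λ x∈ → case ∈-map⁻ Allᵛ.head x∈ of λ where
    (_ ∷ _ , f∈ , x≡) → d f∈ zero x≡)
  (∈-disjointEdges⁺ ns λ {g} g∈ → case ∈-map⁻ Allᵛ.tail g∈ of λ where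
    (_ ∷ _ , f∈ , refl) → d f∈ ∘ suc)

∈-disjointEdges⁻ : (ns : Vec ℕ k) {L : List (Edge ns)} {e f : Edge ns} →
  e ∈ disjointEdges ns L → f ∈ L → VertexDisjoint e f
∈-disjointEdges⁻ (n ∷ ns) {L} {f = y ∷ f} e∈ f∈
  with x , g , x∈ , g∈ , refl ← ∈-cartesianProductWith⁻ _∷_ (complement (map Allᵛ.head L)) _ e∈
  = vertexDisjoint-∷ (y ∷ f)
      (λ where refl → ∈-complement⁻ {xs = map Allᵛ.head L} x∈ (∈-map⁺ Allᵛ.head f∈))
      (∈-disjointEdges⁻ ns g∈ (∈-map⁺ Allᵛ.tail f∈))

-- The ways to add q vertex-disjoint edges with first vertices in A to L. Adding
-- them in the order of A lists each set of new edges once.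
extensions : List (Fin n) → List (Edge (n ∷ ns)) → ℕ → List (List (Edge (n ∷ ns)))
extensions A       L zero    = L ∷ []
extensions []      L (suc q) = []
extensions {ns = ns} (a ∷ A) L (suc q) =
  extensions A L (suc q) ++
  concatMap (λ e → extensions A ((a ∷ e) ∷ L) q) (disjointEdges ns (map Allᵛ.tail L))

record Extendable {n k} {ns : Vec ℕ k} (A : List (Fin n)) (L : List (Edge (n ∷ ns))) : Set where
  field
    unique   : Unique A
    fresh    : ∀ {e} → e ∈ L → Allᵛ.head e ∉ A
    isDisjoint : Disjoint L
open Extendable

extendable-skip : ∀ {a A} → Extendable {ns = ns} (a ∷ A) L → Extendable A L
extendable-skip E = record
  { unique = AllPairs.tail (unique E) ; fresh = λ e∈ → fresh E e∈ ∘ there ; isDisjoint = isDisjoint E }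

head∉ : ∀ {a : Fin n} {A} → Unique (a ∷ A) → a ∉ A
head∉ (a≢ ∷ _) a∈ = All.lookup a≢ a∈ refl

extendable-add : ∀ {a A} → Extendable {ns = ns} (a ∷ A) L → e ∈ disjointEdges ns (map Allᵛ.tail L) →
  Extendable A ((a ∷ e) ∷ L)
extendable-add {ns = ns} {a = a} E e∈ = record
  { unique = AllPairs.tail (unique E)
  ; fresh  = λ where
      (here refl) → head∉ (unique E)
      (there f∈)  → fresh E f∈ ∘ there
  ; isDisjoint = All.tabulate (λ {f} f∈ → vertexDisjoint-∷ f (λ a≡ → fresh E f∈ (here (sym a≡)))
      (∈-disjointEdges⁻ ns e∈ (∈-map⁺ Allᵛ.tail f∈))) ∷ isDisjoint E }

-- Choose which `q` vertices of `A` are used, then the other coordinates in order. In the induction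
-- the two branches contribute the two terms of Pascal's rule, with the same product by `∏-∸-P`.
length-extensions : (A : List (Fin n)) {ns : Vec ℕ k} {L : List (Edge (n ∷ ns))} (q : ℕ) → Extendable A L →
  length (extensions A L q) ≡ (length A C q) * ∏ (Vec.map (λ n → (n ∸ length L) P q) ns)
length-extensions A       {ns} zero    E = sym (trans (*-identityˡ (∏ (Vec.map (λ _ → 1) ns))) (∏-const1 ns))
length-extensions []           (suc q) E = refl
length-extensions (a ∷ A) {ns} {L} (suc q) E = begin
  length (extensions A L (suc q) ++ concatMap branch D)
    ≡⟨ length-++ (extensions A L (suc q)) ⟩
  length (extensions A L (suc q)) + length (concatMap branch D)
    ≡⟨ cong₂ _+_ (length-extensions A (suc q) (extendable-skip E))
         (length-concatMap-const D λ e∈ → length-extensions A q (extendable-add E e∈)) ⟩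
  (length A C suc q) * ∏P l (suc q) + length D * ((length A C q) * ∏P (suc l) q)
    ≡⟨ cong ((length A C suc q) * ∏P l (suc q) +_) step ⟩
  (length A C suc q) * ∏P l (suc q) + (length A C q) * ∏P l (suc q)
    ≡⟨ *-distribʳ-+ (∏P l (suc q)) (length A C suc q) (length A C q) ⟨
  (length A C suc q + length A C q) * ∏P l (suc q)
    ≡⟨ cong (_* ∏P l (suc q)) (trans (+-comm (length A C suc q) _) (nCk+nC[k+1]≡[n+1]C[k+1] (length A) q)) ⟩
  (suc (length A) C suc q) * ∏P l (suc q) ∎
  where
  open ≡-Reasoning
  l = length L
  D = disjointEdges ns (map Allᵛ.tail L)
  branch : Edge ns → List (List (Edge (_ ∷ ns)))
  branch e = extensions A ((a ∷ e) ∷ L) q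
  ∏P : ℕ → ℕ → ℕ
  ∏P l q = ∏ (Vec.map (λ n → (n ∸ l) P q) ns)
  length-D : length D ≡ ∏ (Vec.map (_∸ l) ns)
  length-D = trans (length-disjointEdges ns (disjoint-tails (isDisjoint E)))
    (cong (λ l → ∏ (Vec.map (_∸ l) ns)) (length-map Allᵛ.tail L))
  step : length D * ((length A C q) * ∏P (suc l) q) ≡ (length A C q) * ∏P l (suc q)
  step = begin
    length D * ((length A C q) * ∏P (suc l) q)                    ≡⟨ x∙yz≈y∙xz (length D) (length A C q) _ ⟩
    (length A C q) * (length D * ∏P (suc l) q)                    ≡⟨ cong (λ d → (length A C q) * (d * ∏P (suc l) q)) length-D ⟩
    (length A C q) * (∏ (Vec.map (_∸ l) ns) * ∏P (suc l) q)       ≡⟨ cong ((length A C q) *_) (∏-∸-P ns l q) ⟩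
    (length A C q) * ∏P l (suc q)                                 ∎

record IsExtension {n k} {ns : Vec ℕ k} (A : List (Fin n)) (L : List (Edge (n ∷ ns))) (q : ℕ)
                   (M : List (Edge (n ∷ ns))) : Set where
  field
    isDisjoint : Disjoint M
    size       : length M ≡ q + length L
    extends    : L ⊆ M
    new        : ∀ {e} → e ∈ M → e ∈ L ⊎ Allᵛ.head e ∈ A

∈-extensions⁻ : (A : List (Fin n)) {ns : Vec ℕ k} {L : List (Edge (n ∷ ns))} (q : ℕ) → Extendable A L →
  ∀ {M} → M ∈ extensions A L q → IsExtension A L q M
∈-extensions⁻ A       zero    E (here refl) = record
  { isDisjoint = isDisjoint E ; size = refl ; extends = id ; new = inj₁ }
∈-extensions⁻ (a ∷ A) {ns} {L} (suc q) E M∈ with ∈-++⁻ (extensions A L (suc q)) M∈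
... | inj₁ M∈′ = record
  { IsExtension ext ; new = [ inj₁ , inj₂ ∘ there ]′ ∘ IsExtension.new ext }
  where ext = ∈-extensions⁻ A (suc q) (extendable-skip E) M∈′
... | inj₂ M∈′ with e , e∈ , M∈ₑ ← find (∈-concatMap⁻ (λ e → extensions A ((a ∷ e) ∷ L) q) M∈′) = record
  { isDisjoint = IsExtension.isDisjoint ext
  ; size       = trans (IsExtension.size ext) (+-suc q (length L))
  ; extends    = IsExtension.extends ext ∘ there
  ; new        = λ f∈ → case IsExtension.new ext f∈ of λ where
      (inj₁ (here refl)) → inj₂ (here refl)
      (inj₁ (there f∈L)) → inj₁ f∈L
      (inj₂ h∈)          → inj₂ (there h∈)
  }
  where ext = ∈-extensions⁻ A q (extendable-add E e∈) M∈ₑ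

-- The edge at the first vertex `a` separates the branches: two extensions with different edges at
-- `a` differ by `disjoint-head`, and an extension from the skipping branch has no edge at `a`.
extensions-distinct : (A : List (Fin n)) {ns : Vec ℕ k} {L : List (Edge (n ∷ ns))} (q : ℕ) → Extendable A L →
  AllPairs (λ M N → ¬ M ∼[ set ] N) (extensions A L q)
extensions-distinct A       zero    E = [] ∷ []
extensions-distinct []      (suc q) E = []
extensions-distinct (a ∷ A) {ns} {L} (suc q) E = AllPairs.++⁺
  (extensions-distinct A (suc q) (extendable-skip E))
  (allPairs-concatMap⁺ {f = branch}
    (λ e∈ → extensions-distinct A q (extendable-add E e∈))
    (allPairs-∈ (disjointEdges-unique ns _) λ {e} {f} e∈ f∈ e≢f M∈ N∈ M∼N →
      let extM = ∈-extensions⁻ A q (extendable-add E e∈) M∈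
          extN = ∈-extensions⁻ A q (extendable-add E f∈) N∈
      in case disjoint-head (IsExtension.isDisjoint extN)
            (to M∼N (IsExtension.extends extM (here refl)))
            (IsExtension.extends extN (here refl)) refl of λ where refl → e≢f refl))
  (All.tabulate λ M∈ → All.tabulate λ N∈ M∼N →
    let e , e∈ , N∈′ = find (∈-concatMap⁻ branch N∈)
        extM = ∈-extensions⁻ A (suc q) (extendable-skip E) M∈
        extN = ∈-extensions⁻ A q (extendable-add E e∈) N∈′
    in case IsExtension.new extM (from M∼N (IsExtension.extends extN (here refl))) of λ where
         (inj₁ e∈L) → fresh E e∈L (here refl)
         (inj₂ a∈A) → head∉ (unique E) a∈A)
  where
  branch : Edge ns → List (List (Edge (_ ∷ ns)))
  branch e = extensions A ((a ∷ e) ∷ L) q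

-- The enumeration fixes an order of the edges, so `M` is found only up to set equality. The
-- recursion follows whether `M` has an edge at the head of `A`.
∈-extensions⁺ : (A : List (Fin n)) {ns : Vec ℕ k} {L M : List (Edge (n ∷ ns))} (q : ℕ) → Extendable A L →
  Disjoint M → length M ≡ q + length L → L ⊆ M → (∀ {e} → e ∈ M → e ∈ L ⊎ Allᵛ.head e ∈ A) →
  Any (M ∼[ set ]_) (extensions A L q)
∈-extensions⁺ A zero E dis sz ext new =
  here λ {_} → mk⇔ (unique-⊆⇒⊇ (disjoint⇒unique (isDisjoint E)) ext (≤-reflexive sz)) ext
-- Without candidate vertices `M` lies inside `L`, yet it has more edges.
∈-extensions⁺ [] {L = L} {M} (suc q) E dis sz ext new = contradiction
  (unique-⊆⇒length≤ (disjoint⇒unique dis) (λ e∈ → [ id , (λ ()) ]′ (new e∈)))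
  (<⇒≱ (≤-trans (s≤s (m≤n+m (length L) q)) (≤-reflexive (sym sz))))
∈-extensions⁺ (a ∷ A) {ns} {L} {M} (suc q) E dis sz ext new
  with any? (λ e → Allᵛ.head e Fin.≟ a) M
... | no ¬a = Any.++⁺ˡ (∈-extensions⁺ A (suc q) (extendable-skip E) dis sz ext λ e∈ →
  case new e∈ of λ where
    (inj₁ e∈L)         → inj₁ e∈L
    (inj₂ (here h≡a))  → contradiction (lose e∈ h≡a) ¬a
    (inj₂ (there h∈A)) → inj₂ h∈A)
... | yes p with x ∷ e , e∈ , refl ← find p =
  Any.++⁺ʳ (extensions A L (suc q)) (Any.concat⁺ (Any.map⁺ (lose e∈D
    (∈-extensions⁺ A q (extendable-add E e∈D) dis (trans sz (sym (+-suc q _)))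
      (λ where (here refl) → e∈ ; (there f∈) → ext f∈)
      (λ f∈ → case new f∈ of λ where
        (inj₁ f∈L)         → inj₁ (there f∈L)
        (inj₂ (here h≡x))  → inj₁ (here (disjoint-head dis f∈ e∈ h≡x))
        (inj₂ (there h∈A)) → inj₂ h∈A)))))
  where
  e∈D : e ∈ disjointEdges ns (map Allᵛ.tail L)
  e∈D = ∈-disjointEdges⁺ ns λ g∈ → case ∈-map⁻ Allᵛ.tail g∈ of λ where
    (y ∷ g , f∈ , refl) → disjoint-∈ dis e∈ (ext f∈) (λ where refl → fresh E f∈ (here refl)) ∘ suc

-- Sizes and members of stars

starTerm≡ : (n : ℕ) (ns : Vec ℕ k) (t r : ℕ) →
  starTerm (n ∷ ns) t r ≡ ((n ∸ t) C (r ∸ t)) * ∏ (Vec.map (λ n → (n ∸ t) P (r ∸ t)) ns)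
starTerm≡ n ns t r = begin
  ((n ∸ t) P q) * S / q !         ≡⟨ cong (λ x → x * S / q !) (nCk*k!≡nPk (n ∸ t) q) ⟨
  -- The factorial divides the first falling factorial and leaves a binomial coefficient, so the
  -- division is exact.
  ((n ∸ t) C q) * q ! * S / q !   ≡⟨ cong (_/ q !) (xy∙z≈xz∙y ((n ∸ t) C q) (q !) S) ⟩
  ((n ∸ t) C q) * S * q ! / q !   ≡⟨ m*n/n≡m (((n ∸ t) C q) * S) (q !) ⟩
  ((n ∸ t) C q) * S               ∎
  where
  open ≡-Reasoning
  q = r ∸ t
  S = ∏ (Vec.map (λ n → (n ∸ t) P q) ns)
  instance _ = q !≢0

starTerm*! : (n : ℕ) (ns : Vec ℕ k) (t r : ℕ) →
  starTerm (n ∷ ns) t r * (r ∸ t) ! ≡ ∏ (Vec.map (λ n → (n ∸ t) P (r ∸ t)) (n ∷ ns))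
starTerm*! n ns t r = begin
  starTerm (n ∷ ns) t r * q !     ≡⟨ cong (_* q !) (starTerm≡ n ns t r) ⟩
  ((n ∸ t) C q) * S * q !         ≡⟨ xy∙z≈xz∙y ((n ∸ t) C q) S (q !) ⟩
  ((n ∸ t) C q) * q ! * S         ≡⟨ cong (_* S) (nCk*k!≡nPk (n ∸ t) q) ⟩
  ((n ∸ t) P q) * S               ∎
  where
  open ≡-Reasoning
  q = r ∸ t
  S = ∏ (Vec.map (λ n → (n ∸ t) P q) ns)

-- K is the matching C of a star, renamed because of the binomial _C_.
starMembers : List (Edge (n ∷ ns)) → List ℕ → List (List (Edge (n ∷ ns)))
starMembers K R = concatMap (λ r → extensions (complement (map Allᵛ.head K)) K (r ∸ length K)) R

module _ {n k : ℕ} {ns : Vec ℕ k} {K : List (Edge (n ∷ ns))} (disK : Disjoint K) where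

  private
    V : List (Fin n)
    V = complement (map Allᵛ.head K)
    s = length K

  extendable-complement : Extendable V K
  extendable-complement = record
    { unique     = complement-unique (map Allᵛ.head K)
    ; fresh      = λ e∈ h∈V → ∈-complement⁻ {xs = map Allᵛ.head K} h∈V (∈-map⁺ Allᵛ.head e∈)
    ; isDisjoint = disK
    }

  length-starMembers : ∀ R → length (starMembers K R) ≡ starBound (n ∷ ns) s R
  length-starMembers []      = refl
  length-starMembers (r ∷ R) = trans (length-++ (extensions V K (r ∸ s))) (cong₂ _+_ length-r (length-starMembers R))
    where
    ∏P = ∏ (Vec.map (λ n → (n ∸ s) P (r ∸ s)) ns)
    length-r : length (extensions V K (r ∸ s)) ≡ starTerm (n ∷ ns) s r
    length-r = trans (length-extensions V (r ∸ s) extendable-complement)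
      (trans (cong (λ a → (a C (r ∸ s)) * ∏P)
               (trans (length-complement (disjoint-heads disK)) (cong (n ∸_) (length-map Allᵛ.head K))))
             (sym (starTerm≡ n ns s r)))

  ∈-starMembers⁺ : ∀ {R M} → Disjoint M → length M ∈ R → K ⊆ M → Any (M ∼[ set ]_) (starMembers K R)
  ∈-starMembers⁺ {R} {M} dis len∈R K⊆M = Any.concat⁺ (Any.map⁺ (lose len∈R
    (∈-extensions⁺ V (length M ∸ s) extendable-complement dis
      (sym (m∸n+n≡m (unique-⊆⇒length≤ (disjoint⇒unique disK) K⊆M))) K⊆M new)))
    where
    open DecMembership _≟ᴱ_ using (_∈?_)
    -- An edge of `M` sharing its first vertex with an edge of `K` is that edge, since `K` lies in
    -- `M`.
    new : ∀ {e} → e ∈ M → e ∈ K ⊎ Allᵛ.head e ∈ V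
    new {e} e∈ with e ∈? K
    ... | yes e∈K = inj₁ e∈K
    ... | no  e∉K = inj₂ (∈-complement⁺ {xs = map Allᵛ.head K} λ h∈ →
      let f , f∈ , h≡ = ∈-map⁻ Allᵛ.head h∈ in
      e∉K (subst (_∈ K) (sym (disjoint-head dis e∈ (K⊆M f∈) h≡)) f∈))

  private
    -- `s ≤ r` rules out truncation: for `r < s` the list of extensions would consist of `K` itself,
    -- of size `s`.
    size-∈-extensions : ∀ {r M} → s ≤ r → M ∈ extensions V K (r ∸ s) → length M ≡ r
    size-∈-extensions {r} s≤r M∈ =
      trans (IsExtension.size (∈-extensions⁻ V (r ∸ s) extendable-complement M∈)) (m∸n+n≡m s≤r)

    unique-∈-extensions : ∀ q {M} → M ∈ extensions V K q → Unique M
    unique-∈-extensions q M∈ =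
      disjoint⇒unique (IsExtension.isDisjoint (∈-extensions⁻ V q extendable-complement M∈))

  ∈-starMembers⁻ : ∀ {R M} → All (s ≤_) R → M ∈ starMembers K R → Disjoint M × length M ∈ R × K ⊆ M
  ∈-starMembers⁻ {R} s≤R M∈ =
    let r , r∈ , M∈r = find (∈-concatMap⁻ _ {xs = R} M∈)
        ext = ∈-extensions⁻ V (r ∸ s) extendable-complement M∈r
    in IsExtension.isDisjoint ext
     , subst (_∈ R) (sym (size-∈-extensions (All.lookup s≤R r∈) M∈r)) r∈
     , IsExtension.extends ext

  -- Matchings built for different values of `r` have different sizes, and set-equal matchings have
  -- equal size.
  starMembers-distinct : ∀ {R} → Unique R → All (s ≤_) R →
    AllPairs (λ M N → ¬ M ∼[ set ] N) (starMembers K R)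
  starMembers-distinct uR s≤R = allPairs-concatMap⁺
    (λ {r} _ → extensions-distinct V (r ∸ s) extendable-complement)
    (allPairs-∈ uR λ {r} {r′} r∈ r′∈ r≢r′ M∈ N∈ M∼N →
      r≢r′ (trans (sym (size-∈-extensions (All.lookup s≤R r∈) M∈))
        (trans (≤-antisym
            (unique-⊆⇒length≤ (unique-∈-extensions (r ∸ s) M∈) (to M∼N))
            (unique-⊆⇒length≤ (unique-∈-extensions (r′ ∸ s) N∈) (from M∼N)))
          (size-∈-extensions (All.lookup s≤R r′∈) N∈))))

-- Families inside a star

∼-Any : {L M : List (Edge ns)} {Ns : List (List (Edge ns))} →
  L ∼[ set ] M → Any (M ∼[ set ]_) Ns → Any (L ∼[ set ]_) Ns
∼-Any {ns = ns} {L} {M} L∼M = Any.map step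
  where
  step : ∀ {N} → M ∼[ set ] N → L ∼[ set ] N
  step {N} M∼N = Setoid.trans ([ set ]-Equality (Edge ns)) {L} {M} {N} L∼M M∼N

module SetPigeonhole {k} (ns : Vec ℕ k) = Pigeonhole ([ set ]-Equality (Edge ns))

module _ {ns : Vec ℕ k} {K : Matching (n ∷ ns)} {ℱ : List (Matching (n ∷ ns))}
         (fam : IsFamily R ℱ) (K⊆ℱ : ∀ {M} → M ∈ ℱ → edges K ⊆ edges M) where
  open SetPigeonhole (n ∷ ns)
    renaming (unique-⊆⇒length≤ to distinct-⊆⇒length≤; unique-⊆⇒⊇ to distinct-⊆⇒⊇)
  open SetoidMembership (matchingSetoid (n ∷ ns)) using () renaming (_∈_ to _∈ᴹ_)

  private
    distinct-edges : AllPairs (λ M N → ¬ M ∼[ set ] N) (map edges ℱ)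
    distinct-edges = AllPairs.map⁺ (IsFamily.distinct fam)

    ℱ⊆star : ∀ {M} → Any (M ∼[ set ]_) (map edges ℱ) → Any (M ∼[ set ]_) (starMembers (edges K) R)
    ℱ⊆star {M} M∈ = let N , N∈ , M∼N = find (Any.map⁻ M∈) in
      ∼-Any {L = M} {edges N} M∼N
        (∈-starMembers⁺ (disjoint K) {M = edges N} (disjoint N) (All.lookup (IsFamily.members fam) N∈) (K⊆ℱ N∈))

  length≤starBound : length ℱ ≤ starBound (n ∷ ns) ∣ K ∣ R
  length≤starBound = begin
    length ℱ                           ≡⟨ length-map edges ℱ ⟨
    length (map edges ℱ)               ≤⟨ distinct-⊆⇒length≤ distinct-edges ℱ⊆star ⟩
    length (starMembers (edges K) R)   ≡⟨ length-starMembers (disjoint K) R ⟩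
    starBound (n ∷ ns) ∣ K ∣ R         ∎
    where open ≤-Reasoning

  -- The family consists of distinct members of the enumerated star and has as many entries, so the
  -- inclusion reverses.
  full⇒star⊆ℱ : length ℱ ≡ starBound (n ∷ ns) ∣ K ∣ R →
    ∀ M → M ∈𝒦[ R ] → edges K ⊆ edges M → M ∈ᴹ ℱ
  full⇒star⊆ℱ eq M M∈𝒦 K⊆M = Any.map⁻ (distinct-⊆⇒⊇ distinct-edges ℱ⊆star
    (≤-reflexive (trans (length-starMembers (disjoint K) R) (sym (trans (length-map edges ℱ) eq))))
    (∈-starMembers⁺ (disjoint K) {M = edges M} (disjoint M) M∈𝒦 K⊆M))

isStar⇒length≡starBound : {ns : Vec ℕ k} {ℱ : List (Matching (n ∷ ns))} →
  Unique R → All (t ≤_) R → IsFamily R ℱ → IsStar t R ℱ → length ℱ ≡ starBound (n ∷ ns) t R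
isStar⇒length≡starBound {n = n} {R = R} {ns = ns} {ℱ} uR t≤R fam (K , refl , star) = ≤-antisym
  (length≤starBound {K = K} fam λ {M} M∈ →
    proj₂ (to (star M) (Any.map (λ where refl {_} → mk⇔ id id) M∈)))
  (begin
    starBound (n ∷ ns) ∣ K ∣ R         ≡⟨ length-starMembers (disjoint K) R ⟨
    length (starMembers (edges K) R)   ≤⟨ distinct-⊆⇒length≤ (starMembers-distinct (disjoint K) uR t≤R) star⊆ℱ ⟩
    length (map edges ℱ)               ≡⟨ length-map edges ℱ ⟩
    length ℱ                           ∎)
  where
  open ≤-Reasoning
  open SetPigeonhole (n ∷ ns) renaming (unique-⊆⇒length≤ to distinct-⊆⇒length≤)
  star⊆ℱ : ∀ {M} → Any (M ∼[ set ]_) (starMembers (edges K) R) → Any (M ∼[ set ]_) (map edges ℱ)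
  star⊆ℱ {M} M∈ =
    let N , N∈ , M∼N = find M∈
        dis , len∈R , K⊆N = ∈-starMembers⁻ (disjoint K) t≤R N∈
    in ∼-Any {L = M} {N} M∼N (Any.map⁺ (from (star (matching N dis)) (len∈R , K⊆N)))

-- Comparison of t-stars and (t+1)-stars

1≤nPk : ∀ {n k} → k ≤ n → 1 ≤ n P k
1≤nPk {n}     {zero}  k≤n       = ≤-refl
1≤nPk {suc n} {suc k} (s≤s k≤n) = ≤-trans (*-mono-≤ {1} {suc n} (s≤s z≤n) (1≤nPk k≤n))
  (≤-reflexive (sym (nP[1+k]≡n*[n-1]Pk (suc n) k)))

1≤∏ : {f : ℕ → ℕ} → Allᵛ (λ n → 1 ≤ f n) ns → 1 ≤ ∏ (Vec.map f ns)
1≤∏ []       = ≤-refl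
1≤∏ (p ∷ ps) = *-mono-≤ p (1≤∏ ps)

1≤starTerm : ∀ {t r} → Allᵛ (r ≤_) (n ∷ ns) → 1 ≤ starTerm (n ∷ ns) t r
1≤starTerm {n = n} {ns = ns} {t} {r} r≤ns = 1≤m*n⇒1≤m
  (≤-trans (1≤∏ (Allᵛ.map (λ r≤n → 1≤nPk (∸-monoˡ-≤ t r≤n)) r≤ns)) (≤-reflexive (sym (starTerm*! n ns t r))))
  where
  1≤m*n⇒1≤m : ∀ {m n} → 1 ≤ m * n → 1 ≤ m
  1≤m*n⇒1≤m {suc m} _ = s≤s z≤n

-- A double count of pairs of an `r`-matching containing a fixed `t`-matching and one further edge
-- of it: each matching has `r ∸ t` such edges, and each edge disjoint from the `t`-matching lies in
-- as many matchings as a `(t+1)`-star has of size `r`.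
starTerm-step : (n : ℕ) (ns : Vec ℕ k) {t r : ℕ} → t < r →
  (r ∸ t) * starTerm (n ∷ ns) t r ≡ ∏ (Vec.map (_∸ t) (n ∷ ns)) * starTerm (n ∷ ns) (suc t) r
starTerm-step n ns {t} {r} t<r = *-cancelʳ-≡ _ _ (q !) {{q !≢0}} (begin
  (r ∸ t) * X * q !                   ≡⟨ cong (λ p → p * X * q !) r∸t≡ ⟩
  suc q * X * q !                     ≡⟨ xy∙z≈y∙xz (suc q) X (q !) ⟩
  X * (suc q) !                       ≡⟨ cong (λ p → X * p !) r∸t≡ ⟨
  X * (r ∸ t) !                       ≡⟨ starTerm*! n ns t r ⟩
  ∏ (Vec.map (λ n → (n ∸ t) P (r ∸ t)) (n ∷ ns))
    ≡⟨ cong (λ p → ∏ (Vec.map (λ n → (n ∸ t) P p) (n ∷ ns))) r∸t≡ ⟩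
  ∏ (Vec.map (λ n → (n ∸ t) P suc q) (n ∷ ns))
    ≡⟨ ∏-∸-P (n ∷ ns) t q ⟨
  Z * ∏ (Vec.map (λ n → (n ∸ suc t) P q) (n ∷ ns))
    ≡⟨ cong (Z *_) (starTerm*! n ns (suc t) r) ⟨
  Z * (Y * q !)                       ≡⟨ *-assoc Z Y (q !) ⟨
  Z * Y * q !                         ∎)
  where
  open ≡-Reasoning
  q = r ∸ suc t
  X = starTerm (n ∷ ns) t r
  Y = starTerm (n ∷ ns) (suc t) r
  Z = ∏ (Vec.map (_∸ t) (n ∷ ns))
  r∸t≡ : r ∸ t ≡ suc q
  r∸t≡ = +-∸-assoc 1 t<r

starTerm-gap : ∀ {c m t r n₁ n₂} → 1 ≤ m → t < r → r ≤ m → Allᵛ (r ≤_) (n₁ ∷ n₂ ∷ ns) →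
  m + m * suc c ≤ n₂ → c * starTerm (n₁ ∷ n₂ ∷ ns) (suc t) r < starTerm (n₁ ∷ n₂ ∷ ns) t r
starTerm-gap {ns = ns} {c} {m} {t} {r} {n₁} {n₂} 1≤m t<r r≤m r≤ns@(r≤n₁ ∷ r≤n₂ ∷ r≤ns′) n₀≤n₂ =
  -- The stronger `suc c * Y ≤ X` is proved; the extra copy of `Y`, being at least 1, yields
  -- strictness. Cancelling `m` uses `r ∸ t ≤ m`.
  ≤-trans (+-monoˡ-≤ (c * Y) (1≤starTerm {t = suc t} r≤ns))
    (*-cancelˡ-≤ m {{>-nonZero 1≤m}} (begin
      m * (suc c * Y)                        ≡⟨ *-assoc m (suc c) Y ⟨
      m * suc c * Y                          ≤⟨ *-monoˡ-≤ Y m[1+c]≤Z ⟩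
      ∏ (Vec.map (_∸ t) (n₁ ∷ n₂ ∷ ns)) * Y   ≡⟨ starTerm-step n₁ (n₂ ∷ ns) t<r ⟨
      (r ∸ t) * X                            ≤⟨ *-monoˡ-≤ X (≤-trans (m∸n≤m r t) r≤m) ⟩
      m * X                                  ∎))
  where
  open ≤-Reasoning
  X = starTerm (n₁ ∷ n₂ ∷ ns) t r
  Y = starTerm (n₁ ∷ n₂ ∷ ns) (suc t) r
  1≤∸ : ∀ {n} → r ≤ n → 1 ≤ n ∸ t
  1≤∸ r≤n = m<n⇒0<n∸m (≤-trans t<r r≤n)
  bound : m * suc c + t ≤ n₂
  bound = ≤-trans (≤-reflexive (+-comm (m * suc c) t))
    (≤-trans (+-monoˡ-≤ (m * suc c) (≤-trans (<⇒≤ t<r) r≤m)) n₀≤n₂)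
  m[1+c]≤Z : m * suc c ≤ ∏ (Vec.map (_∸ t) (n₁ ∷ n₂ ∷ ns))
  m[1+c]≤Z = begin
    m * suc c                                         ≤⟨ m+n≤o⇒m≤o∸n (m * suc c) bound ⟩
    n₂ ∸ t                                            ≡⟨ trans (*-identityˡ _) (*-identityʳ _) ⟨
    -- `n₂` alone is known to be large; the other factors are at least 1 because `t < r` and `r` is
    -- at most every part size.
    1 * ((n₂ ∸ t) * 1)                                ≤⟨ *-mono-≤ (1≤∸ r≤n₁) (*-monoʳ-≤ (n₂ ∸ t) (1≤∏ (Allᵛ.map 1≤∸ r≤ns′))) ⟩
    (n₁ ∸ t) * ((n₂ ∸ t) * ∏ (Vec.map (_∸ t) ns))     ∎

-- Each `r` in `R` gives a surplus of at least 1, whence `length R`. The filter drops sizes too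
-- small to contain `suc t` edges; by truncated subtraction their `starTerm` at `suc t` would be 1
-- instead of 0.
starBound-gap : ∀ {c m t n₁ n₂} R → 1 ≤ m → All (λ r → r ≤ m × Allᵛ (r ≤_) (n₁ ∷ n₂ ∷ ns)) R →
  m + m * suc c ≤ n₂ →
  c * starBound (n₁ ∷ n₂ ∷ ns) (suc t) (filter (t <?_) R) + length R ≤ starBound (n₁ ∷ n₂ ∷ ns) t R
starBound-gap {c = c} []      1≤m []             n₀≤n₂ = ≤-reflexive (trans (+-identityʳ (c * 0)) (*-zeroʳ c))
starBound-gap {ns = ns} {c} {t = t} {n₁} {n₂} (r ∷ R) 1≤m ((r≤m , r≤ns) ∷ bs) n₀≤n₂ with t <? r
... | no t≮r rewrite filter-reject (t <?_) {xs = R} t≮r = begin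
  c * β + suc (length R)     ≡⟨ +-suc (c * β) (length R) ⟩
  1 + (c * β + length R)     ≤⟨ +-mono-≤ (1≤starTerm {t = t} r≤ns) (starBound-gap R 1≤m bs n₀≤n₂) ⟩
  starBound (n₁ ∷ n₂ ∷ ns) t (r ∷ R) ∎
  where
  open ≤-Reasoning
  β : ℕ
  β = starBound (n₁ ∷ n₂ ∷ ns) (suc t) (filter (t <?_) R)
... | yes t<r rewrite filter-accept (t <?_) {xs = R} t<r = begin
  c * (Y + β) + suc (length R)           ≡⟨ cong (_+ suc (length R)) (*-distribˡ-+ c Y β) ⟩
  c * Y + c * β + suc (length R)         ≡⟨ +-suc _ _ ⟩
  suc (c * Y + c * β + length R)         ≡⟨ cong suc (+-assoc (c * Y) (c * β) (length R)) ⟩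
  suc (c * Y) + (c * β + length R)       ≤⟨ +-mono-≤ (starTerm-gap 1≤m t<r r≤m r≤ns n₀≤n₂) (starBound-gap R 1≤m bs n₀≤n₂) ⟩
  starBound (n₁ ∷ n₂ ∷ ns) t (r ∷ R)     ∎
  where
  open ≤-Reasoning
  Y = starTerm (n₁ ∷ n₂ ∷ ns) (suc t) r
  β : ℕ
  β = starBound (n₁ ∷ n₂ ∷ ns) (suc t) (filter (t <?_) R)

-- Intersecting families

isFamily-filter : ∀ {p} {P : Pred (Matching ns) p} (P? : Decidable P) → IsFamily R ℱ → IsFamily R (filter P? ℱ)
isFamily-filter P? fam = record
  { members  = All.filter⁺ P? (IsFamily.members fam)
  ; distinct = AllPairs.filter⁺ P? (IsFamily.distinct fam)
  }

-- `K` need only be a list of distinct edges: if the family has a member, `K` inherits disjointness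
-- from it. Members have at least `length K` edges, so smaller sizes can be filtered out of `R`.
degree≤starBound : {ns : Vec ℕ k} {ℱ : List (Matching (n ∷ ns))} {K : List (Edge (n ∷ ns))} →
  IsFamily R ℱ → Unique K → (∀ {M} → M ∈ ℱ → K ⊆ edges M) →
  length ℱ ≤ starBound (n ∷ ns) (length K) (filter (length K ≤?_) R)
degree≤starBound {ℱ = []}             fam uK K⊆ = z≤n
degree≤starBound {R = R} {ℱ = M ∷ _} {K} fam uK K⊆ = length≤starBound {K = matching K disK}
  (record
    { members  = All.tabulate λ M∈ →
        ∈-filter⁺ (length K ≤?_) (All.lookup (IsFamily.members fam) M∈) (unique-⊆⇒length≤ uK (K⊆ M∈))
    ; distinct = IsFamily.distinct fam
    }) K⊆
  where
  disK : Disjoint K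
  disK = allPairs-∈ uK λ x∈ y∈ → disjoint-∈ (disjoint M) (K⊆ (here refl) x∈) (K⊆ (here refl) y∈)

module _ {n k : ℕ} {ns : Vec ℕ k} where
  open DecMembership (_≟ᴱ_ {ns = n ∷ ns}) using (_∈?_; _∉?_)

  -- If all common edges of `N` and `M` lay in `T`, then, being at least as many as `T` has, they
  -- would exhaust `T`, forcing `T` into `N`.
  edge-outside : {T N M : List (Edge (n ∷ ns))} → Disjoint N →
    ¬ All (_∈ N) T → length T ≤ length (filter (_∈? M) N) → Any (λ e → e ∈ M × e ∉ T) N
  edge-outside {T} {N} {M} disN T⊈N T≤N∩M
    with any? (λ e → (e ∈? M) ×-dec (e ∉? T)) N
  ... | yes e = e
  ... | no ¬e = contradiction (All.tabulate T⊆N) T⊈N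
    where
    N∩M⊆T : filter (_∈? M) N ⊆ T
    N∩M⊆T {x} x∈ with x∈N , x∈M ← ∈-filter⁻ (_∈? M) {xs = N} x∈ =
      decidable-stable (x ∈? T) λ x∉T → ¬e (lose x∈N (x∈M , x∉T))
    T⊆N : T ⊆ N
    T⊆N x∈T = proj₁ (∈-filter⁻ (_∈? M) {xs = N}
      (unique-⊆⇒⊇ (Unique.filter⁺ (_∈? M) (disjoint⇒unique disN)) N∩M⊆T T≤N∩M x∈T))

  module _ {m t : ℕ} {R : List ℕ} {ℱ : List (Matching (n ∷ ns))} (fam : IsFamily R ℱ) (int : Intersecting t ℱ)
           (R≤m : All (_≤ m) R) where

    private
      β : ℕ
      β = starBound (n ∷ ns) (suc t) (filter (t <?_) R)
      ∣_∣≤m : ∀ {M} → M ∈ ℱ → ∣ M ∣ ≤ m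
      ∣ M∈ ∣≤m = All.lookup R≤m (All.lookup (IsFamily.members fam) M∈)
      _⊆?_ : (T : List (Edge (n ∷ ns))) → Decidable (λ M → All (_∈ edges M) T)
      T ⊆? M = All.all? (_∈? edges M) T

    -- Let `N` miss an edge of `T`. Every member containing `T` also contains one of the at most `m`
    -- edges of `N`, outside `T`, and at most `β` members contain `T` together with that edge.
    degree≤-nontrivial : {T : List (Edge (n ∷ ns))} → Disjoint T → length T ≡ t →
      Any (λ M → ¬ All (_∈ edges M) T) ℱ → length (filter (T ⊆?_) ℱ) ≤ m * β
    degree≤-nontrivial {T} disT refl T⊈ with N , N∈ , T⊈N ← find T⊈ = ≤-trans
      (length-cover Q? (edges N) ℱT
        (λ {M} M∈ → edge-outside {M = edges M} (disjoint N) T⊈N (int N∈ (proj₁ (∈-filter⁻ (T ⊆?_) {xs = ℱ} M∈))))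
        deg≤)
      (*-monoˡ-≤ β ∣ N∈ ∣≤m)
      where
      ℱT = filter (T ⊆?_) ℱ
      Q? : (e : Edge (n ∷ ns)) → Decidable (λ M → e ∈ edges M × e ∉ T)
      Q? e M = (e ∈? edges M) ×-dec (e ∉? T)
      deg≤ : ∀ {e N} → e ∈ N → length (filter (Q? e) ℱT) ≤ β
      -- For `e` outside `T`, `e ∷ T` has `suc t` distinct edges; for `e` in `T`, no member
      -- satisfies `Q? e`.
      deg≤ {e} _ = case e ∈? T of λ where
        (no e∉T) → degree≤starBound (isFamily-filter (Q? e) (isFamily-filter (T ⊆?_) fam))
          (All.tabulate (λ where f∈T refl → e∉T f∈T) ∷ disjoint⇒unique disT)
          λ M∈ → let M∈ℱT , e∈M , _ = ∈-filter⁻ (Q? e) {xs = ℱT} M∈ in λ where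
            (here refl) → e∈M
            (there f∈T) → All.lookup (proj₂ (∈-filter⁻ (T ⊆?_) {xs = ℱ} M∈ℱT)) f∈T
        (yes e∈T) → ≤-trans (≤-reflexive (cong length
          (filter-none (Q? e) {xs = ℱT} (All.universal (λ _ (_ , e∉T) → e∉T e∈T) ℱT)))) z≤n

    -- Every member shares `t` edges with `M₀`, hence contains one of the at most `2 ^ m` sublists
    -- in `choose t (edges M₀)`.
    length≤-nontrivial : ∀ {M₀} → M₀ ∈ ℱ →
      All (λ T → Any (λ M → ¬ All (_∈ edges M) T) ℱ) (choose t (edges M₀)) →
      length ℱ ≤ 2 ^ m * m * β
    length≤-nontrivial {M₀} M₀∈ nontriv = begin
      length ℱ
        ≤⟨ length-cover _⊆?_ (choose t (edges M₀)) ℱ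
             (λ {M} M∈ → choose-filter (_∈? edges M) t (edges M₀) (int M₀∈ M∈))
             (λ T∈ → degree≤-nontrivial (allPairs-∈-choose t (disjoint M₀) T∈)
               (length-∈-choose t (edges M₀) T∈) (All.lookup nontriv T∈)) ⟩
      length (choose t (edges M₀)) * (m * β)
        ≤⟨ *-monoˡ-≤ (m * β) (≤-trans (length-choose≤ t (edges M₀)) (^-monoʳ-≤ 2 ∣ M₀∈ ∣≤m)) ⟩
      2 ^ m * (m * β)              ≡⟨ *-assoc (2 ^ m) m β ⟨
      2 ^ m * m * β                ∎
      where open ≤-Reasoning

  trivial⊎nontrivial : ∀ t (M₀ : List (Edge (n ∷ ns))) (ℱ : List (Matching (n ∷ ns))) →
    (∃ λ T → T ∈ choose t M₀ × All (λ M → All (_∈ edges M) T) ℱ) ⊎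
    All (λ T → Any (λ M → ¬ All (_∈ edges M) T) ℱ) (choose t M₀)
  trivial⊎nontrivial t M₀ ℱ with any? (λ T → All.all? (λ M → All.all? (_∈? edges M) T) ℱ) (choose t M₀)
  ... | yes triv = inj₁ (find triv)
  ... | no ¬triv = inj₂ (All.map (λ {T} → All.¬All⇒Any¬ (λ M → All.all? (_∈? edges M) T) ℱ) (All.¬Any⇒All¬ _ ¬triv))

length≤starBound×full⇒isStar : {ns : Vec ℕ k} {ℱ : List (Matching (n ∷ ns))} →
  IsFamily R ℱ → (K : Matching (n ∷ ns)) → ∣ K ∣ ≡ t → (∀ {M} → M ∈ ℱ → edges K ⊆ edges M) →
  length ℱ ≤ starBound (n ∷ ns) t R × (length ℱ ≡ starBound (n ∷ ns) t R → IsStar t R ℱ)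
length≤starBound×full⇒isStar {R = R} {ns = ns} {ℱ} fam K refl K⊆ℱ =
  length≤starBound {K = K} fam K⊆ℱ , λ full → K , refl , λ M → mk⇔
    (λ M∈ → ∈𝒦 {M} M∈ , λ {_} → K⊆ {M} M∈) (uncurry (full⇒star⊆ℱ {K = K} fam K⊆ℱ full M))
  where
  open SetoidMembership (matchingSetoid (_ ∷ ns)) using () renaming (_∈_ to _∈ᴹ_)
  -- A member up to reordering need not be listed in `ℱ`; its size and its containing `K` are
  -- transported from the listed copy.
  representative : ∀ {M} → M ∈ᴹ ℱ → ∃ λ N → N ∈ ℱ × edges M ∼[ set ] edges N
  representative {M} = find {P = λ N → edges M ∼[ set ] edges N}
  ∈𝒦 : ∀ {M} → M ∈ᴹ ℱ → M ∈𝒦[ R ]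
  ∈𝒦 {M} M∈ = let N , N∈ , M∼N = representative {M} M∈ in
    subst (_∈ R) (≤-antisym
        (unique-⊆⇒length≤ (disjoint⇒unique (disjoint N)) (from M∼N))
        (unique-⊆⇒length≤ (disjoint⇒unique (disjoint M)) (to M∼N)))
      (All.lookup (IsFamily.members fam) N∈)
  K⊆ : ∀ {M} → M ∈ᴹ ℱ → edges K ⊆ edges M
  K⊆ {M} M∈ e∈ = let N , N∈ , M∼N = representative {M} M∈ in from M∼N (K⊆ℱ N∈ e∈)

theorem3p5 : ∀ (m : ℕ) → 1 ≤ m →
    ∃ λ (n₀ : ℕ) →
      ∀ (j t n₁ n₂ : ℕ) (n₃⋯ : Vec ℕ j) (R : List ℕ) →
      let ns : Vec ℕ (2 + j)
          ns = n₁ ∷ n₂ ∷ n₃⋯ in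
      1 ≤ t →
      1 ≤ n₁ → Linked _≤_ ns →
      Unique R → R ≢ [] → All (λ r → 1 ≤ r × r ≤ n₁) R →
      t ≤ min n₁ R → max 0 R ≡ m → n₀ ≤ n₂ →
      (ℱ : List (Matching ns)) → IsFamily R ℱ → Intersecting t ℱ →
      length ℱ ≤ starBound ns t R ×
      (length ℱ ≡ starBound ns t R ⇔ IsStar t R ℱ)
-- With `c = 2 ^ m * m` from the bound on nontrivial families, `starBound-gap` asks for
-- `m + m * suc c ≤ n₂`; the first `m` absorbs `t`.
theorem3p5 m 1≤m = m + m * suc (2 ^ m * m) , main
  where
  main : ∀ j t n₁ n₂ (n₃⋯ : Vec ℕ j) R → let ns = n₁ ∷ n₂ ∷ n₃⋯ in
    1 ≤ t → 1 ≤ n₁ → Linked _≤_ ns →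
    Unique R → R ≢ [] → All (λ r → 1 ≤ r × r ≤ n₁) R →
    t ≤ min n₁ R → max 0 R ≡ m → m + m * suc (2 ^ m * m) ≤ n₂ →
    (ℱ : List (Matching ns)) → IsFamily R ℱ → Intersecting t ℱ →
    length ℱ ≤ starBound ns t R × (length ℱ ≡ starBound ns t R ⇔ IsStar t R ℱ)
  main j t n₁ n₂ n₃⋯ R _ _ linked uR R≢[] R⊆[n₁] t≤min max≡m n₀≤n₂ ℱ fam int =
    let l≤b , star = bound ℱ fam int in l≤b , mk⇔ star (isStar⇒length≡starBound uR t≤R fam)
    where
    sizes = n₁ ∷ n₂ ∷ n₃⋯
    t≤R : All (t ≤_) R
    -- For non-empty `R` within `[n₁]` the defaults `n₁` of `min` and 0 of `max` do not alter the
    -- minimum and maximum.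
    t≤R = All.map (≤-trans t≤min) (min≤xs n₁ R)
    R≤m : All (_≤ m) R
    R≤m = subst (λ x → All (_≤ x) R) max≡m (xs≤max 0 R)
    0<length : ∀ {R : List ℕ} → R ≢ [] → 0 < length R
    0<length {[]}    R≢[] = contradiction refl R≢[]
    0<length {_ ∷ _} _    = s≤s z≤n
    gap : 2 ^ m * m * starBound sizes (suc t) (filter (t <?_) R) < starBound sizes t R
    -- Strict because `R` is non-empty; the ordering of the parts extends `r ≤ n₁` to all part
    -- sizes.
    gap = <-≤-trans (m<m+n _ (0<length R≢[]))
      (starBound-gap R 1≤m
        (All.zipWith (λ (r≤m , (_ , r≤n₁)) → r≤m , Linked⇒All ≤-trans r≤n₁ linked) (R≤m , R⊆[n₁])) n₀≤n₂)
    strict : ∀ {l} {X : Set} → l < starBound sizes t R → l ≤ starBound sizes t R × (l ≡ starBound sizes t R → X)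
    strict l<b = <⇒≤ l<b , λ l≡b → contradiction l≡b (<⇒≢ l<b)
    bound : ∀ ℱ → IsFamily R ℱ → Intersecting t ℱ →
      length ℱ ≤ starBound sizes t R × (length ℱ ≡ starBound sizes t R → IsStar t R ℱ)
    -- The gap makes the star bound positive, so the empty family never attains it.
    bound [] _ _ = strict (≤-<-trans z≤n gap)
    bound ℱ@(M₀ ∷ _) fam int with trivial⊎nontrivial t (edges M₀) ℱ
    ... | inj₂ nontriv = strict (≤-<-trans (length≤-nontrivial fam int R≤m (here refl) nontriv) gap)
    ... | inj₁ (T , T∈ , T⊆) = length≤starBound×full⇒isStar fam
      (matching T (allPairs-∈-choose t (disjoint M₀) T∈)) (length-∈-choose t (edges M₀) T∈)
      (λ M∈ → All.lookup (All.lookup T⊆ M∈))
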